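{- Let $n,f$ be positive integers such that $2^{f/2}=O(n)$. Any $f$-FDO with an arbitrary finite stretch for $n$-vertex directed graphs requires $\Omega(2^{f/2}\, n)$ bits of space, regardless of the query time.
   Context: For a directed graph $G=(V,E)$ and $F\subseteq E$, $G-F$ is $G$ with the edges of $F$ removed; $\mathrm{diam}(H)=\max_{s,t} d_H(s,t)$, which is $+\infty$ if $H$ is not strongly connected. An $f$-FDO ($f$-edge fault-tolerant diameter oracle) for $G$ is a data structure built from $G$ that, on query a set $F\subseteq E$ with $|F|\le f$, returns a value $\widehat{D}(F)$; it has stretch $\sigma\ge 1$ if always $\mathrm{diam}(G-F)\le \widehat{D}(F)\le \sigma\cdot \mathrm{diam}(G-F)$. A finite stretch $\sigma$ in particular forces $\widehat D(F)=+\infty$ exactly when $\mathrm{diam}(G-F)=+\infty$. -}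

module Defs where

open import Data.Bool.Base using (Bool)
open import Data.Fin.Base using (Fin)
open import Data.Fin.Subset using (Subset; _∈_; _∉_; _⊆_; _─_; ∣_∣)
open import Data.Fin.Subset.Properties using (p─q⊆p)
open import Data.Integer.Base using (+_)
open import Data.List.Base using (List; length)
open import Data.Nat.Base using (ℕ; zero; suc; _*_; _^_; _≤_)
open import Data.Product.Base using (_×_; ∃₂)
open import Data.Rational.Base as ℚ using (ℚ; 1ℚ)
open import Data.Vec.Base using (Vec; lookup; map; sum; zipWith)
open import Data.Vec.Properties using (lookup-zipWith)
open import Relation.Binary.PropositionalEquality.Core using (subst)
open import Relation.Nullary.Construct.Add.Supremum using (_⁺; [_]; ⊤⁺)
open import Relation.Nullary.Negation.Core using (¬_)
import Relation.Binary.Construct.Add.Supremum.NonStrict as AddSup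

open AddSup _≤_ public using () renaming (_≤⁺_ to _≤∞_)
open AddSup ℚ._≤_ public using () renaming (_≤⁺_ to _≤ℚ∞_)

-- Row u is the set of heads v of the edges u → v.
EdgeSet : ℕ → Set
EdgeSet n = Vec (Subset n) n

module _ {n : ℕ} where

  _⊆ᴱ_ : EdgeSet n → EdgeSet n → Set
  F ⊆ᴱ E = ∀ u → lookup F u ⊆ lookup E u

  ∣_∣ᴱ : EdgeSet n → ℕ
  ∣ F ∣ᴱ = sum (map ∣_∣ F)

record Digraph (n : ℕ) : Set where
  constructor mkDigraph
  field
    edges     : EdgeSet n
    .loopless : ∀ u → u ∉ lookup edges u

open Digraph public

module _ {n : ℕ} where

  infixl 6 _-ᴱ_

  _-ᴱ_ : Digraph n → EdgeSet n → Digraph n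
  mkDigraph E loop-free -ᴱ F = mkDigraph (zipWith _─_ E F) λ u u∈ →
    loop-free u (p─q⊆p (lookup E u) (lookup F u)
      (subst (u ∈_) (lookup-zipWith _─_ u E F) u∈))

  data Walk (H : Digraph n) : Fin n → Fin n → ℕ → Set where
    nil  : ∀ {u} → Walk H u u zero
    cons : ∀ {u v w ℓ} → v ∈ lookup (edges H) u → Walk H v w ℓ →
           Walk H u w (suc ℓ)

  IsDist : Digraph n → Fin n → Fin n → ℕ ⁺ → Set
  IsDist H s t [ d ] = Walk H s t d × (∀ ℓ → Walk H s t ℓ → d ≤ ℓ)
  IsDist H s t ⊤⁺    = ∀ ℓ → ¬ Walk H s t ℓ

  IsDiam : Digraph n → ℕ ⁺ → Set
  IsDiam H D = (∀ s t d → IsDist H s t d → d ≤∞ D)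
             × ∃₂ λ s t → IsDist H s t D

ℕ∞⇒ℚ∞ : ℕ ⁺ → ℚ ⁺
ℕ∞⇒ℚ∞ [ d ] = [ + d ℚ./ 1 ]
ℕ∞⇒ℚ∞ ⊤⁺    = ⊤⁺

-- Only used with a factor ≥ 1, whence the clause for ∞.
_·∞_ : ℚ → ℚ ⁺ → ℚ ⁺
σ ·∞ [ x ] = [ σ ℚ.* x ]
σ ·∞ ⊤⁺    = ⊤⁺

-- A query sees only the stored bit string and the fault set, never the graph.
-- Both maps are arbitrary functions, so nothing is assumed about the
-- preprocessing or query time, and they may depend on n and f.
record FDO (n f : ℕ) : Set where
  field
    build : Digraph n → List Bool
    query : List Bool → (F : EdgeSet n) → .(∣ F ∣ᴱ ≤ f) → ℚ ⁺

open FDO public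

module _ {n f : ℕ} where

  HasStretch : FDO n f → ℚ → Set
  HasStretch O σ = 1ℚ ℚ.≤ σ ×
    (∀ (G : Digraph n) (F : EdgeSet n) → F ⊆ᴱ edges G →
     (∣F∣≤f : ∣ F ∣ᴱ ≤ f) (D : ℕ ⁺) → IsDiam (G -ᴱ F) D →
     let D̂ = query O (build O G) F ∣F∣≤f in
     (ℕ∞⇒ℚ∞ D ≤ℚ∞ D̂) × (D̂ ≤ℚ∞ (σ ·∞ ℕ∞⇒ℚ∞ D)))

  UsesSpace≤ : FDO n f → ℕ → Set
  UsesSpace≤ O b = ∀ G → length (build O G) ≤ b

infix 4 2^[_/2]·_≤_

-- 2^(f/2) · m ≤ x, squared to avoid the square root when f is odd.
2^[_/2]·_≤_ : ℕ → ℕ → ℕ → Set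
2^[ f /2]· m ≤ x = 2 ^ f * m ^ 2 ≤ x ^ 2

{-# OPTIONS --safe #-}
module Submission where

-- Every finite stretch decides strong connectivity of G − F, so it suffices to
-- hide bits in this property. A block consists of a complete binary out-tree
-- of depth h, a complete binary in-tree of depth h and an exit; the arcs from
-- leaves of the first tree to leaves of the second encode a 2^h × 2^h bit
-- matrix. All vertices of a block lead back to the root of its out-tree, both
-- tree roots lead to the exit, the exit to every hub, and the hubs to
-- everything else. To read off the bit at leaves (a , β) of a block, delete its
-- arc from the out-root to the exit and, for every arc on the paths from the
-- out-root to a and from β to the in-root, the sibling arc. These are 2h + 1
-- faults, after which the out-root can escape its block only via the arc a → β.
-- With about n / 2^(h+3) blocks this stores Ω(2^h n) bits, and the build map
-- must be injective on the resulting graphs.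

open import Defs
open import Data.Bool.Base using (Bool; true; false; not)
open import Data.Bool.Properties using (¬-not)
import Data.Bool.Properties as Bool
open import Data.Fin.Base using (Fin; zero; suc; toℕ; fromℕ; fromℕ<; combine; quotient; remainder)
import Data.Fin.Properties as Fin
import Data.Fin.Subset as Subset
open Subset using (Subset; _─_; ∣_∣; inside; outside)
open import Data.Fin.Subset.Properties using (∉⊥; ∣⊥∣≡0; p─q⊆p; _∈?_; x∈p∧x∉q⇒x∈p─q)
open import Data.List.Base as List using (List; []; _∷_; _++_; length)
open import Data.List.Membership.Propositional using (_∈_)
open import Data.List.Membership.Propositional.Properties using (∈-map⁺; ∈-map⁻; ∈-++⁺ˡ; ∈-++⁺ʳ; ∈-++⁻)
import Data.List.Properties as List
open import Data.List.Relation.Unary.Any using (here; there)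
open import Data.Nat.Base using (ℕ; zero; suc; _+_; _*_; _∸_; _^_; _/_; _%_; _≤_; _<_; z≤n; s≤s; z<s; NonZero)
open import Data.Nat.DivMod using (_mod_; m≡m%n+[m/n]*n; [m+kn]%n≡m%n; m<n⇒m%n≡m; m<n⇒m/n≡0; m*n/n≡m; m%n<n; m/n*n≤m; +-distrib-/-∣ʳ; m≥n⇒m/n>0)
open import Data.Nat.Divisibility using (divides-refl)
open import Data.Nat.Induction using (<-rec)
open import Data.Nat.Properties
open import Data.Nat.Solver using (module +-*-Solver)
open import Data.Product.Base using (_×_; _,_; ∃; ∃₂; proj₁; proj₂; uncurry)
open import Data.Rational.Base using (ℚ)
import Data.Rational.Properties as ℚ
open import Data.Sum.Base using (_⊎_; inj₁; inj₂)
open import Data.Vec.Base as Vec using (Vec; []; _∷_; lookup; _[_]%=_; _[_]≔_)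
import Data.Vec.Properties as Vec
open import Function.Base using (_∘_)
open import Function.Bundles using (mk⇔)
open import Relation.Binary.Construct.Add.Supremum.NonStrict using (≤⁺-trans; [_]; _≤⊤⁺)
open import Relation.Binary.PropositionalEquality
open import Relation.Nullary.Construct.Add.Supremum using ([_]; ⊤⁺)
open import Relation.Nullary.Decidable using (Dec; yes; no; does; map′; _×-dec_; dec-true)
open import Relation.Nullary.Negation using (¬_; contradiction)

-- Diameters of strongly connected digraphs

module _ {n : ℕ} where

  Reach : Digraph n → Fin n → Fin n → Set
  Reach H s t = ∃ (Walk H s t)

  module _ {H : Digraph n} where

    _◅◅_ : ∀ {s t u ℓ ℓ′} → Walk H s t ℓ → Walk H t u ℓ′ → Walk H s u (ℓ + ℓ′)
    nil      ◅◅ q = q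
    cons e p ◅◅ q = cons e (p ◅◅ q)

    Reach-refl : ∀ {s t} → s ≡ t → Reach H s t
    Reach-refl refl = 0 , nil

    Reach-trans : ∀ {s t u} → Reach H s t → Reach H t u → Reach H s u
    Reach-trans (_ , p) (_ , q) = _ , p ◅◅ q

    walk? : ∀ s t ℓ → Dec (Walk H s t ℓ)
    walk? s t zero    = map′ (λ { refl → nil }) (λ { nil → refl }) (s Fin.≟ t)
    walk? s t (suc ℓ) =
      map′ (λ (_ , e , p) → cons e p) (λ { (cons e p) → _ , e , p })
        (Fin.any? λ v → (v ∈? lookup (edges H) s) ×-dec walk? v t ℓ)

    -- Having a walk of a given length is decidable, so a walk can be exchanged for a shorter one
    -- until there is none.
    distance : ∀ {s t} → Reach H s t → ∃ λ d → IsDist H s t [ d ]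
    distance {s} {t} (ℓ , p) = <-rec _ shorten ℓ p
      where
      shorten : ∀ ℓ → (∀ {ℓ′} → ℓ′ < ℓ → Walk H s t ℓ′ → ∃ λ d → IsDist H s t [ d ]) →
                Walk H s t ℓ → ∃ λ d → IsDist H s t [ d ]
      shorten ℓ rec p with anyUpTo? (walk? s t) ℓ
      ... | yes (_ , ℓ′<ℓ , q) = rec ℓ′<ℓ q
      ... | no  none           = ℓ , p , λ ℓ′ q → ≮⇒≥ λ ℓ′<ℓ → none (ℓ′ , ℓ′<ℓ , q)

maximiser : ∀ {n} (g : Fin (suc n) → ℕ) → ∃ λ i → ∀ j → g j ≤ g i
maximiser {zero}  g = zero , λ { zero → ≤-refl }
maximiser {suc n} g with maximiser (g ∘ suc)
... | i , max with ≤-total (g zero) (g (suc i))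
...   | inj₁ g₀≤gᵢ = suc i , λ { zero → g₀≤gᵢ ; (suc j) → max j }
...   | inj₂ gᵢ≤g₀ = zero  , λ { zero → ≤-refl ; (suc j) → ≤-trans (max j) gᵢ≤g₀ }

finite-diameter : ∀ {n} {H : Digraph (suc n)} → (∀ s t → Reach H s t) →
                  ∃ λ D → IsDiam H [ D ]
finite-diameter {n} {H} reach = dist s (far s) , bound , s , far s , isDist s (far s)
  where
  dist : Fin (suc n) → Fin (suc n) → ℕ
  dist s t = proj₁ (distance (reach s t))
  isDist : ∀ s t → IsDist H s t [ dist s t ]
  isDist s t = proj₂ (distance (reach s t))
  far : Fin (suc n) → Fin (suc n)
  far s = proj₁ (maximiser (dist s))
  s : Fin (suc n)
  s = proj₁ (maximiser λ s → dist s (far s))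
  bound : ∀ u v d → IsDist H u v d → d ≤∞ [ dist s (far s) ]
  bound u v [ d ] (_ , d≤) = [ begin
    d               ≤⟨ d≤ _ (proj₁ (isDist u v)) ⟩
    dist u v        ≤⟨ proj₂ (maximiser (dist u)) v ⟩
    dist u (far u)  ≤⟨ proj₂ (maximiser λ s → dist s (far s)) u ⟩
    dist s (far s)  ∎ ]
    where open ≤-Reasoning
  bound u v ⊤⁺ none = contradiction (proj₂ (reach u v)) (none _)

infinite-diameter : ∀ {n} {H : Digraph n} {s t} → ¬ Reach H s t → IsDiam H ⊤⁺
infinite-diameter none = (λ _ _ d _ → d ≤⊤⁺) , _ , _ , λ ℓ p → none (ℓ , p)

-- If the encodings agreed, both graphs would get the same answer to the query `F`: infinite on
-- account of `G′`, yet at most `σ` times `D` on account of `G`.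
stretch-separates : ∀ {n f σ} {O : FDO n f} → HasStretch O σ →
  ∀ {G G′ F D} → F ⊆ᴱ edges G → F ⊆ᴱ edges G′ → ∣ F ∣ᴱ ≤ f →
  IsDiam (G -ᴱ F) [ D ] → IsDiam (G′ -ᴱ F) ⊤⁺ → build O G ≢ build O G′
stretch-separates {σ = σ} {O} (_ , stretch) {G} {G′} {F} {D} F⊆G F⊆G′ ∣F∣≤f diam diam′ eq
  with ≤⁺-trans _ ℚ.≤-trans
         (proj₁ (stretch G′ F F⊆G′ ∣F∣≤f _ diam′))
         (subst (λ bs → query O bs F ∣F∣≤f ≤ℚ∞ (σ ·∞ ℕ∞⇒ℚ∞ [ D ])) eq
           (proj₂ (stretch G F F⊆G ∣F∣≤f _ diam)))
... | ()

-- Edge sets given by relations and by lists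

x∈p─q⇒x∉q : ∀ {n} {x : Fin n} (p q : Subset n) → x Subset.∈ p ─ q → x Subset.∉ q
x∈p─q⇒x∉q (_ ∷ p) (outside ∷ q) (Vec.there x∈) (Vec.there x∈q) = x∈p─q⇒x∉q p q x∈ x∈q
x∈p─q⇒x∉q (_ ∷ p) (inside  ∷ q) (Vec.there x∈) (Vec.there x∈q) = x∈p─q⇒x∉q p q x∈ x∈q

module _ {n : ℕ} {R : Fin n → Fin n → Set} (R? : ∀ u v → Dec (R u v)) where

  relation : EdgeSet n
  relation = Vec.tabulate λ u → Vec.tabulate λ v → does (R? u v)

  private
    entry : ∀ u v → lookup (lookup relation u) v ≡ does (R? u v)
    entry u v = trans
      (cong (λ row → lookup row v) (Vec.lookup∘tabulate (λ u → Vec.tabulate λ v → does (R? u v)) u))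
      (Vec.lookup∘tabulate (λ v → does (R? u v)) v)

  relation⁺ : ∀ {u v} → R u v → v Subset.∈ lookup relation u
  relation⁺ {u} {v} r = Vec.lookup⇒[]= v _ (trans (entry u v) (dec-true (R? u v) r))

  relation⁻ : ∀ {u v} → v Subset.∈ lookup relation u → R u v
  relation⁻ {u} {v} v∈ with R? u v | trans (sym (entry u v)) (Vec.[]=⇒lookup v∈)
  ... | yes r | _ = r

module _ {n : ℕ} where

  -- The number `m` of rows is kept apart from `n` so that `size-insert` can recurse on the rows.
  insert : ∀ {m} → Fin m × Fin n → Vec (Subset n) m → Vec (Subset n) m
  insert (u , v) F = F [ u ]%= (_[ v ]≔ inside)

  fromList : ∀ {m} → List (Fin m × Fin n) → Vec (Subset n) m
  fromList = List.foldr insert (Vec.replicate _ Subset.⊥)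

  insert⁺ : ∀ {m u v x y} (F : Vec (Subset n) m) →
            (u , v) ≡ (x , y) ⊎ v Subset.∈ lookup F u → v Subset.∈ lookup (insert (x , y) F) u
  insert⁺ {u = u} {v} F (inj₁ refl)
    rewrite Vec.lookup∘updateAt u {_[ v ]≔ inside} F =
    Vec.lookup⇒[]= v _ (Vec.lookup∘updateAt v (lookup F u))
  insert⁺ {u = u} {v} {x} {y} F (inj₂ v∈) with u Fin.≟ x
  ... | no u≢x rewrite Vec.lookup∘updateAt′ u x {_[ y ]≔ inside} u≢x F = v∈
  ... | yes refl rewrite Vec.lookup∘updateAt u {_[ y ]≔ inside} F with v Fin.≟ y
  ...   | yes refl = Vec.lookup⇒[]= v _ (Vec.lookup∘updateAt v (lookup F u))
  ...   | no v≢y   = Vec.lookup⇒[]= v _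
                       (trans (Vec.lookup∘updateAt′ v y v≢y (lookup F u)) (Vec.[]=⇒lookup v∈))

  insert⁻ : ∀ {m u v x y} (F : Vec (Subset n) m) →
            v Subset.∈ lookup (insert (x , y) F) u → (u , v) ≡ (x , y) ⊎ v Subset.∈ lookup F u
  insert⁻ {u = u} {v} {x} {y} F v∈ with u Fin.≟ x
  ... | no u≢x rewrite Vec.lookup∘updateAt′ u x {_[ y ]≔ inside} u≢x F = inj₂ v∈
  ... | yes refl rewrite Vec.lookup∘updateAt u {_[ y ]≔ inside} F with v Fin.≟ y
  ...   | yes refl = inj₁ refl
  ...   | no v≢y   = inj₂ (Vec.lookup⇒[]= v _
                       (trans (sym (Vec.lookup∘updateAt′ v y v≢y (lookup F u))) (Vec.[]=⇒lookup v∈)))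

  fromList⁺ : ∀ {m} (L : List (Fin m × Fin n)) {u v} → (u , v) ∈ L → v Subset.∈ lookup (fromList L) u
  fromList⁺ (_ ∷ L) (here eq)  = insert⁺ (fromList L) (inj₁ eq)
  fromList⁺ (_ ∷ L) (there e∈) = insert⁺ (fromList L) (inj₂ (fromList⁺ L e∈))

  fromList⁻ : ∀ {m} (L : List (Fin m × Fin n)) {u v} → v Subset.∈ lookup (fromList L) u → (u , v) ∈ L
  fromList⁻ [] {u} {v} v∈ =
    contradiction (subst (v Subset.∈_) (Vec.lookup-replicate u Subset.⊥) v∈) ∉⊥
  fromList⁻ (_ ∷ L) v∈ with insert⁻ (fromList L) v∈
  ... | inj₁ eq = here eq
  ... | inj₂ e∈ = there (fromList⁻ L e∈)

  ∣set∣≤ : ∀ {n} (p : Subset n) v → ∣ p [ v ]≔ inside ∣ ≤ suc ∣ p ∣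
  ∣set∣≤ (inside  ∷ p) zero    = n≤1+n _
  ∣set∣≤ (outside ∷ p) zero    = ≤-refl
  ∣set∣≤ (inside  ∷ p) (suc v) = s≤s (∣set∣≤ p v)
  ∣set∣≤ (outside ∷ p) (suc v) = ∣set∣≤ p v

  size : ∀ {m} → Vec (Subset n) m → ℕ
  size F = Vec.sum (Vec.map ∣_∣ F)

  size-insert : ∀ {m} (e : Fin m × Fin n) (F : Vec (Subset n) m) → size (insert e F) ≤ suc (size F)
  size-insert (zero  , v) (p ∷ F) = +-monoˡ-≤ (size F) (∣set∣≤ p v)
  size-insert (suc u , v) (p ∷ F) = begin
    ∣ p ∣ + size (insert (u , v) F)  ≤⟨ +-monoʳ-≤ ∣ p ∣ (size-insert (u , v) F) ⟩
    ∣ p ∣ + suc (size F)             ≡⟨ +-suc ∣ p ∣ (size F) ⟩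
    suc (∣ p ∣ + size F)             ∎
    where open ≤-Reasoning

  -- Repeated entries collapse, hence an inequality; the fault budget asks for no more.
  size-fromList : ∀ {m} (L : List (Fin m × Fin n)) → size (fromList L) ≤ length L
  size-fromList {m} [] = ≤-reflexive (size-empty m)
    where
    size-empty : ∀ m → size (Vec.replicate m (Subset.⊥ {n})) ≡ 0
    size-empty zero    = refl
    size-empty (suc m) = cong₂ _+_ (∣⊥∣≡0 n) (size-empty m)
  size-fromList (e ∷ L) = ≤-trans (size-insert e (fromList L)) (s≤s (size-fromList L))

-- Bit strings

-- Bijective base-2 numeration, least significant digit first.
rank : List Bool → ℕ
rank []          = 0
rank (false ∷ w) = suc (rank w + rank w)
rank (true  ∷ w) = suc (suc (rank w + rank w))

increment : List Bool → List Bool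
increment []          = false ∷ []
increment (false ∷ w) = true ∷ w
increment (true  ∷ w) = false ∷ increment w

unrank : ℕ → List Bool
unrank zero    = []
unrank (suc k) = increment (unrank k)

rank-increment : ∀ w → rank (increment w) ≡ suc (rank w)
rank-increment []          = refl
rank-increment (false ∷ w) = refl
rank-increment (true  ∷ w) rewrite rank-increment w = cong (2 +_) (+-suc (rank w) (rank w))

rank-unrank : ∀ k → rank (unrank k) ≡ k
rank-unrank zero    = refl
rank-unrank (suc k) = trans (rank-increment (unrank k)) (cong suc (rank-unrank k))

-- The induction rests on two increments turning `false ∷ w` into `false ∷ increment w`.
unrank-double : ∀ k → unrank (suc (k + k)) ≡ false ∷ unrank k
unrank-double zero    = refl
unrank-double (suc k) rewrite +-suc k k | unrank-double k = refl

unrank-rank : ∀ w → unrank (rank w) ≡ w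
unrank-rank []          = refl
unrank-rank (false ∷ w) = trans (unrank-double (rank w)) (cong (false ∷_) (unrank-rank w))
unrank-rank (true  ∷ w) =
  cong increment (trans (unrank-double (rank w)) (cong (false ∷_) (unrank-rank w)))

rank-injective : ∀ {v w} → rank v ≡ rank w → v ≡ w
rank-injective {v} {w} eq = trans (sym (unrank-rank v)) (trans (cong unrank eq) (unrank-rank w))

-- There are `2 ^ (l + 1) - 1` strings of length at most `l`, and ranks start at 0.
rank< : ∀ w → 2 + rank w ≤ 2 ^ suc (length w)
rank< []      = ≤-refl
rank< (b ∷ w) = begin
  2 + rank (b ∷ w)             ≤⟨ +-monoʳ-≤ 2 (digit b) ⟩
  2 + (2 + (rank w + rank w))  ≡⟨ solve 1 (λ r → con 2 :+ (con 2 :+ (r :+ r)) := con 2 :* (con 2 :+ r)) refl (rank w) ⟩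
  2 * (2 + rank w)             ≤⟨ *-monoʳ-≤ 2 (rank< w) ⟩
  2 ^ suc (length (b ∷ w))     ∎
  where
  open ≤-Reasoning
  open +-*-Solver
  digit : ∀ b → rank (b ∷ w) ≤ 2 + (rank w + rank w)
  digit false = n≤1+n _
  digit true  = ≤-refl

bit : Fin 2 → Bool
bit zero       = false
bit (suc zero) = true

bit-injective : ∀ {i j} → bit i ≡ bit j → i ≡ j
bit-injective {zero}     {zero}     _ = refl
bit-injective {zero}     {suc zero} ()
bit-injective {suc zero} {zero}     ()
bit-injective {suc zero} {suc zero} _ = refl

remQuot-injective : ∀ {m} k {i j : Fin (m * k)} → quotient {m} k i ≡ quotient {m} k j →
                    remainder {m} k i ≡ remainder {m} k j → i ≡ j
remQuot-injective {m} k {i} {j} q≡ r≡ =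
  trans (sym (Fin.combine-remQuot {m} k i)) (trans (cong₂ combine q≡ r≡) (Fin.combine-remQuot {m} k j))

bits : ∀ m → Fin (2 ^ m) → Vec Bool m
bits zero    _ = []
bits (suc m) r = bit (quotient (2 ^ m) r) ∷ bits m (remainder {2} (2 ^ m) r)

bits-injective : ∀ m {r r′} → bits m r ≡ bits m r′ → r ≡ r′
bits-injective zero    {zero} {zero} _ = refl
bits-injective (suc m) eq =
  remQuot-injective {2} (2 ^ m) (bit-injective (Vec.∷-injectiveˡ eq)) (bits-injective m (Vec.∷-injectiveʳ eq))

lookup-injective : ∀ {A : Set} {m} {xs ys : Vec A m} → (∀ i → lookup xs i ≡ lookup ys i) → xs ≡ ys
lookup-injective {xs = xs} {ys} eq =
  trans (sym (Vec.tabulate∘lookup xs)) (trans (Vec.tabulate-cong eq) (Vec.tabulate∘lookup ys))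

-- Pigeonhole on ranks: only `2 ^ (b + 1) - 1` strings have length at most `b`. The missing one
-- makes the bound `m ≤ b` rather than `m ≤ b + 1`.
incompressible : ∀ {m b} (code : Vec Bool m → List Bool) → (∀ Y → length (code Y) ≤ b) →
                 (∀ {Y Y′} → code Y ≡ code Y′ → Y ≡ Y′) → m ≤ b
incompressible {m} {b} code short injective =
  ≮⇒≥ λ b<m → <-irrefl refl (begin-strict
    2 ^ m          ≤⟨ Fin.injective⇒≤ {f = index} (λ eq → bits-injective m (injective
                        (rank-injective (trans (sym (Fin.toℕ-fromℕ< _)) (trans (cong toℕ eq) (Fin.toℕ-fromℕ< _)))))) ⟩
    2 ^ suc b ∸ 1  <⟨ pred-< ⟩
    2 ^ suc b      ≤⟨ ^-monoʳ-≤ 2 b<m ⟩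
    2 ^ m          ∎)
  where
  open ≤-Reasoning
  pred-< : 2 ^ suc b ∸ 1 < 2 ^ suc b
  pred-< = ∸-monoʳ-< z<s (m^n>0 2 (suc b))
  rank-code : ∀ Y → rank (code Y) < 2 ^ suc b ∸ 1
  rank-code Y = ∸-monoˡ-≤ 1 (≤-trans (rank< (code Y)) (^-monoʳ-≤ 2 (s≤s (short Y))))
  index : Fin (2 ^ m) → Fin (2 ^ suc b ∸ 1)
  index r = fromℕ< (rank-code (bits m r))

-- Binary trees

-- A node of the infinite binary tree is the path to it from the root, last
-- step first, so that the parent of a node is its tail.
data _≼_ : List Bool → List Bool → Set where
  here  : ∀ {a} → a ≼ a
  there : ∀ {p a b} → p ≼ a → p ≼ (b ∷ a)

root≼ : ∀ a → [] ≼ a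
root≼ []      = here
root≼ (_ ∷ a) = there (root≼ a)

≼-parent : ∀ {b p a} → (b ∷ p) ≼ a → p ≼ a
≼-parent here        = there here
≼-parent (there p≼a) = there (≼-parent p≼a)

≼-length : ∀ {p a} → p ≼ a → length p ≤ length a
≼-length here        = ≤-refl
≼-length (there p≼a) = m≤n⇒m≤1+n (≼-length p≼a)

≼-same-length : ∀ {p a} → p ≼ a → length p ≡ length a → p ≡ a
≼-same-length here        _  = refl
≼-same-length (there p≼a) eq = contradiction (≼-length p≼a) (<⇒≱ (≤-reflexive (sym eq)))

-- The pair (p , c) stands for the child c ∷ p of p.
siblings : List Bool → List (List Bool × Bool)
siblings []      = []
siblings (b ∷ a) = (a , not b) ∷ siblings a

length-siblings : ∀ a → length (siblings a) ≡ length a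
length-siblings []      = refl
length-siblings (_ ∷ a) = cong suc (length-siblings a)

siblings-length : ∀ a {p c} → (p , c) ∈ siblings a → length p < length a
siblings-length (_ ∷ a) (here refl) = ≤-refl
siblings-length (_ ∷ a) (there s∈)  = m≤n⇒m≤1+n (siblings-length a s∈)

-- Keeps the path to `a` intact when the siblings are cut off: at the depth of a sibling, the path
-- passes through the other child.
siblings-off : ∀ a {p c} → (p , c) ∈ siblings a → ¬ (c ∷ p) ≼ a
siblings-off (false ∷ a) (here refl) (there p≼a) = <-irrefl refl (≼-length p≼a)
siblings-off (true  ∷ a) (here refl) (there p≼a) = <-irrefl refl (≼-length p≼a)
siblings-off (_ ∷ a)     (there s∈)  here        = <-irrefl refl (siblings-length a s∈)
siblings-off (_ ∷ a)     (there s∈)  (there p≼a) = siblings-off a s∈ p≼a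

-- Confines walks once the siblings are cut off: a node on the path is its end, or one child
-- continues the path and the other is a listed sibling.
branch : ∀ {p a} → p ≼ a → p ≡ a ⊎ ∃ λ b → (b ∷ p) ≼ a × (p , not b) ∈ siblings a
branch here = inj₁ refl
branch (there p≼a) with branch p≼a
... | inj₁ refl             = inj₂ (_ , here , here refl)
... | inj₂ (b , bp≼a , s∈) = inj₂ (b , there bp≼a , there s∈)

-- The gadgets

-- In both trees a node is addressed by its path from the root; the arcs of the in-tree point from
-- child to parent.
data Place : Set where
  exit    : Place
  out inn : List Bool → Place

data Vertex : Set where
  hub : Vertex
  at  : ℕ → Place → Vertex

-- A tag bit in front of the path turns places into bit strings bijectively. The exit and both trees
-- of depth `h` are the words of length at most `h + 1`, with ranks 0 to `2 ^ (2 + h) - 2`.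
word : Place → List Bool
word exit    = []
word (out p) = false ∷ p
word (inn p) = true ∷ p

place : List Bool → Place
place []          = exit
place (false ∷ p) = out p
place (true  ∷ p) = inn p

place-word : ∀ k → place (word k) ≡ k
place-word exit    = refl
place-word (out _) = refl
place-word (inn _) = refl

word-place : ∀ w → word (place w) ≡ w
word-place []          = refl
word-place (false ∷ _) = refl
word-place (true  ∷ _) = refl

data Cut (a β : List Bool) : Place → Place → Set where
  detour : Cut a β (out []) exit
  grow   : ∀ {p c} → (p , c) ∈ siblings a → Cut a β (out p) (out (c ∷ p))
  shrink : ∀ {p c} → (p , c) ∈ siblings β → Cut a β (inn (c ∷ p)) (inn p)

cuts : List Bool → List Bool → List (Place × Place)
cuts a β = (out [] , exit)
         ∷ List.map (λ (p , c) → out p , out (c ∷ p)) (siblings a)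
        ++ List.map (λ (p , c) → inn (c ∷ p) , inn p) (siblings β)

cuts⁺ : ∀ {a β k l} → Cut a β k l → (k , l) ∈ cuts a β
cuts⁺ detour      = here refl
cuts⁺ (grow s∈)   = there (∈-++⁺ˡ (∈-map⁺ _ s∈))
cuts⁺ (shrink s∈) = there (∈-++⁺ʳ _ (∈-map⁺ _ s∈))

cuts⁻ : ∀ {a β k l} → (k , l) ∈ cuts a β → Cut a β k l
cuts⁻ (here refl) = detour
cuts⁻ {a} (there e∈) with ∈-++⁻ (List.map _ (siblings a)) e∈
... | inj₁ e∈ with _ , s∈ , refl ← ∈-map⁻ _ e∈ = grow s∈
... | inj₂ e∈ with _ , s∈ , refl ← ∈-map⁻ _ e∈ = shrink s∈

length-cuts : ∀ a β → length (cuts a β) ≡ suc (length a + length β)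
length-cuts a β = cong suc (trans (List.length-++ (List.map _ (siblings a)))
  (cong₂ _+_ (trans (List.length-map _ (siblings a)) (length-siblings a))
             (trans (List.length-map _ (siblings β)) (length-siblings β))))

-- Ensures that both ends of a fault are places for which `label-vertex` holds.
cut-length : ∀ {a β h k l} → length a ≤ h → length β ≤ h → Cut a β k l →
             length (word k) ≤ suc h × length (word l) ≤ suc h
cut-length _ _ detour = s≤s z≤n , z≤n
cut-length a≤h _ (grow s∈) = m≤n⇒m≤1+n p<h , s≤s p<h
  where p<h = ≤-trans (siblings-length _ s∈) a≤h
cut-length _ β≤h (shrink s∈) = s≤s p<h , m≤n⇒m≤1+n p<h
  where p<h = ≤-trans (siblings-length _ s∈) β≤h

-- Graphs that store a bit vector

module Construction
  (h s n′ : ℕ) .{{_ : NonZero s}} (s-large : 2 ^ (2 + h) ≤ s)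
  {m : ℕ} (block : Fin m → ℕ) (row col : Fin m → List Bool)
  (block< : ∀ q → block q < n′ / s)
  (∣row∣ : ∀ q → length (row q) ≡ h) (∣col∣ : ∀ q → length (col q) ≡ h)
  (position-injective : ∀ {q r} → block q ≡ block r → row q ≡ row r → col q ≡ col r → q ≡ r)
  where

  private
    n = suc n′
    M = n′ / s

  -- Block `i` occupies the `s` numbers from `i * s` on, with each place at the rank of its word.
  -- Reduction modulo `n` makes the map total; it changes nothing under the bounds of `toℕ-vertex`.
  vertex : ℕ → Place → Fin n
  vertex i k = (rank (word k) + i * s) mod n

  -- Every residue below `s` is read as a place, so a block may contain tree nodes deeper than `h`.
  -- These too have arcs back to the root of the out-tree.
  label : Fin n → Vertex
  label u with toℕ u / s <? M
  ... | yes _ = at (toℕ u / s) (place (unrank (toℕ u % s)))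
  ... | no  _ = hub

  rank-word< : ∀ k → length (word k) ≤ suc h → rank (word k) < s
  rank-word< k short = ≤-trans (n≤1+n _) (≤-trans (rank< (word k)) (≤-trans (^-monoʳ-≤ 2 (s≤s short)) s-large))

  toℕ-vertex : ∀ {i k} → i < M → length (word k) ≤ suc h →
               toℕ (vertex i k) ≡ rank (word k) + i * s
  toℕ-vertex {i} {k} i<M short = trans (Fin.toℕ-fromℕ< _) (m<n⇒m%n≡m (s≤s (begin
    rank (word k) + i * s  ≤⟨ +-monoˡ-≤ (i * s) (<⇒≤ (rank-word< k short)) ⟩
    suc i * s              ≤⟨ *-monoˡ-≤ s i<M ⟩
    M * s                  ≤⟨ m/n*n≤m n′ s ⟩
    n′                     ∎)))
    where open ≤-Reasoning

  label-vertex : ∀ {i k} → i < M → length (word k) ≤ suc h → label (vertex i k) ≡ at i k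
  label-vertex {i} {k} i<M short with toℕ (vertex i k) / s <? M | quot | rem
    where
    r<s = rank-word< k short
    quot : toℕ (vertex i k) / s ≡ i
    quot = begin
      toℕ (vertex i k) / s             ≡⟨ cong (_/ s) (toℕ-vertex i<M short) ⟩
      (rank (word k) + i * s) / s      ≡⟨ +-distrib-/-∣ʳ (rank (word k)) (divides-refl i) ⟩
      rank (word k) / s + i * s / s    ≡⟨ cong₂ _+_ (m<n⇒m/n≡0 r<s) (m*n/n≡m i s) ⟩
      i                                ∎
      where open ≡-Reasoning
    rem : toℕ (vertex i k) % s ≡ rank (word k)
    rem = begin
      toℕ (vertex i k) % s         ≡⟨ cong (_% s) (toℕ-vertex i<M short) ⟩
      (rank (word k) + i * s) % s  ≡⟨ [m+kn]%n≡m%n (rank (word k)) i s ⟩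
      rank (word k) % s            ≡⟨ m<n⇒m%n≡m r<s ⟩
      rank (word k)                ∎
      where open ≡-Reasoning
  ... | yes _    | quot | rem = cong₂ at quot
          (trans (cong (place ∘ unrank) rem) (trans (cong place (unrank-rank (word k))) (place-word k)))
  ... | no  i≮M | quot | _   = contradiction (subst (_< M) (sym quot) i<M) i≮M

  label⁻ : ∀ {u i k} → label u ≡ at i k → i < M × u ≡ vertex i k
  label⁻ {u} eq with toℕ u / s <? M
  label⁻ {u} refl | yes i<M = i<M , Fin.toℕ-injective (begin
    toℕ u                                                    ≡⟨ m<n⇒m%n≡m (Fin.toℕ<n u) ⟨
    toℕ u % n                                                ≡⟨ cong (_% n) (m≡m%n+[m/n]*n (toℕ u) s) ⟩
    (toℕ u % s + i * s) % n                                  ≡⟨ cong (λ r → (r + i * s) % n) (rank-unrank (toℕ u % s)) ⟨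
    (rank (unrank (toℕ u % s)) + i * s) % n                  ≡⟨ cong (λ w → (rank w + i * s) % n) (word-place (unrank (toℕ u % s))) ⟨
    (rank (word (place (unrank (toℕ u % s)))) + i * s) % n   ≡⟨ Fin.toℕ-fromℕ< _ ⟨
    toℕ (vertex i (place (unrank (toℕ u % s))))              ∎)
    where
    open ≡-Reasoning
    i = toℕ u / s

  -- The blocks fit into the first `n′` numbers, so the last vertex is always a hub.
  someHub : Fin n
  someHub = fromℕ n′

  label-someHub : label someHub ≡ hub
  label-someHub with toℕ (fromℕ n′) / s <? M
  ... | yes lt = contradiction (subst (λ x → x / s < M) (Fin.toℕ-fromℕ n′) lt) (<-irrefl refl)
  ... | no  _  = refl

  -- Only `entry` arcs depend on `Y`. The side condition of `return` avoids a loop at the root.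
  data Link (Y : Vec Bool m) (i : ℕ) : Place → Place → Set where
    return : ∀ {k} → k ≢ out [] → Link Y i k (out [])
    detour : Link Y i (out []) exit
    grow   : ∀ {p c} → Link Y i (out p) (out (c ∷ p))
    entry  : ∀ {p r} q → lookup Y q ≡ true → block q ≡ i → row q ≡ p → col q ≡ r →
             Link Y i (out p) (inn r)
    shrink : ∀ {p c} → Link Y i (inn (c ∷ p)) (inn p)
    finish : Link Y i (inn []) exit

  data Arc (Y : Vec Bool m) : Vertex → Vertex → Set where
    spread : ∀ {i k} → Arc Y hub (at i k)
    leave  : ∀ {i} → Arc Y (at i exit) hub
    within : ∀ {i k l} → Link Y i k l → Arc Y (at i k) (at i l)

  link? : ∀ Y i k l → Dec (Link Y i k l)
  link? Y i exit          exit          = no λ ()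
  link? Y i exit          (out [])      = yes (return λ ())
  link? Y i exit          (out (_ ∷ _)) = no λ ()
  link? Y i exit          (inn _)       = no λ ()
  link? Y i (out [])      exit          = yes detour
  link? Y i (out (_ ∷ _)) exit          = no λ ()
  link? Y i (out [])      (out [])      = no λ { (return ≢) → ≢ refl }
  link? Y i (out (_ ∷ _)) (out [])      = yes (return λ ())
  link? Y i (out p)       (out (c ∷ r)) = map′ (λ { refl → grow }) (λ { grow → refl }) (List.≡-dec Bool._≟_ p r)
  link? Y i (out p)       (inn r)       =
    map′ (λ (q , y , b≡ , r≡ , c≡) → entry q y b≡ r≡ c≡) (λ { (entry q y b≡ r≡ c≡) → q , y , b≡ , r≡ , c≡ })
      (Fin.any? λ q → (lookup Y q Bool.≟ true) ×-dec (block q ≟ i)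
        ×-dec (List.≡-dec Bool._≟_ (row q) p) ×-dec (List.≡-dec Bool._≟_ (col q) r))
  link? Y i (inn [])      exit          = yes finish
  link? Y i (inn (_ ∷ _)) exit          = no λ ()
  link? Y i (inn _)       (out [])      = yes (return λ ())
  link? Y i (inn _)       (out (_ ∷ _)) = no λ ()
  link? Y i (inn [])      (inn _)       = no λ ()
  link? Y i (inn (c ∷ p)) (inn r)       = map′ (λ { refl → shrink }) (λ { shrink → refl }) (List.≡-dec Bool._≟_ p r)

  arc? : ∀ Y x y → Dec (Arc Y x y)
  arc? Y hub      hub      = no λ ()
  arc? Y hub      (at _ _) = yes spread
  arc? Y (at i exit)    hub = yes leave
  arc? Y (at i (out _)) hub = no λ ()
  arc? Y (at i (inn _)) hub = no λ ()
  arc? Y (at i k) (at j l) with i ≟ j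
  ... | no i≢j   = no λ { (within _) → i≢j refl }
  ... | yes refl = map′ within (λ { (within link) → link }) (link? Y i k l)

  arc-irrefl : ∀ {Y x} → ¬ Arc Y x x
  arc-irrefl (within (return ≢)) = ≢ refl

  graph : Vec Bool m → Digraph n
  graph Y = mkDigraph (relation λ u v → arc? Y (label u) (label v))
              λ u u∈ → arc-irrefl (relation⁻ (λ u v → arc? Y (label u) (label v)) u∈)

  -- The faults that expose one bit

  data Severed (q : Fin m) : Vertex → Vertex → Set where
    severed : ∀ {k l} → Cut (row q) (col q) k l → Severed q (at (block q) k) (at (block q) l)

  faultList : Fin m → List (Fin n × Fin n)
  faultList q = List.map (λ (k , l) → vertex (block q) k , vertex (block q) l) (cuts (row q) (col q))

  faults : Fin m → EdgeSet n
  faults q = fromList (faultList q)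

  ∣faults∣ : ∀ q → ∣ faults q ∣ᴱ ≤ suc (h + h)
  ∣faults∣ q = begin
    ∣ faults q ∣ᴱ                                ≤⟨ size-fromList (faultList q) ⟩
    length (faultList q)                         ≡⟨ List.length-map _ (cuts (row q) (col q)) ⟩
    length (cuts (row q) (col q))                ≡⟨ length-cuts (row q) (col q) ⟩
    suc (length (row q) + length (col q))        ≡⟨ cong suc (cong₂ _+_ (∣row∣ q) (∣col∣ q)) ⟩
    suc (h + h)                                  ∎
    where open ≤-Reasoning

  faults⁺ : ∀ {q u v} → Severed q (label u) (label v) → v Subset.∈ lookup (faults q) u
  faults⁺ {q} {u} {v} sev = fromList⁺ (faultList q) (listed refl refl sev)
    where
    listed : ∀ {x y} → label u ≡ x → label v ≡ y → Severed q x y → (u , v) ∈ faultList q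
    listed u≡ v≡ (severed cut) =
      subst (_∈ faultList q) (cong₂ _,_ (sym (proj₂ (label⁻ u≡))) (sym (proj₂ (label⁻ v≡))))
        (∈-map⁺ _ (cuts⁺ cut))

  faults⁻ : ∀ {q u v} → v Subset.∈ lookup (faults q) u → Severed q (label u) (label v)
  faults⁻ {q} v∈ with (k , l) , e∈ , refl ← ∈-map⁻ _ (fromList⁻ (faultList q) v∈)
    with cut ← cuts⁻ e∈
    with k≤ , l≤ ← cut-length (≤-reflexive (∣row∣ q)) (≤-reflexive (∣col∣ q)) cut =
    subst₂ (Severed q) (sym (label-vertex (block< q) k≤)) (sym (label-vertex (block< q) l≤)) (severed cut)

  -- No fault is an `entry` arc, so one fault set is a legitimate query for every `Y`; this allows
  -- two graphs to be compared by the same query.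
  severed⇒arc : ∀ {Y q x y} → Severed q x y → Arc Y x y
  severed⇒arc (severed detour)     = within detour
  severed⇒arc (severed (grow _))   = within grow
  severed⇒arc (severed (shrink _)) = within shrink

  faults⊆ : ∀ Y q → faults q ⊆ᴱ edges (graph Y)
  faults⊆ Y q u v∈ = relation⁺ (λ u v → arc? Y (label u) (label v)) (severed⇒arc (faults⁻ v∈))

  -- Connectivity after the faults

  module _ (Y : Vec Bool m) (q : Fin m) where

    private
      H = graph Y -ᴱ faults q
      i = block q
      a = row q
      β = col q

    edge⁺ : ∀ {u v} → Arc Y (label u) (label v) → ¬ Severed q (label u) (label v) →
            v Subset.∈ lookup (edges H) u
    edge⁺ {u} {v} arc ¬sev = subst (v Subset.∈_) (sym (Vec.lookup-zipWith _─_ u (edges (graph Y)) (faults q)))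
      (x∈p∧x∉q⇒x∈p─q (relation⁺ (λ u v → arc? Y (label u) (label v)) arc) (¬sev ∘ faults⁻))

    edge⁻ : ∀ {u v} → v Subset.∈ lookup (edges H) u →
            Arc Y (label u) (label v) × ¬ Severed q (label u) (label v)
    edge⁻ {u} {v} v∈ =
      relation⁻ (λ u v → arc? Y (label u) (label v)) (p─q⊆p _ _ v∈─) , x∈p─q⇒x∉q _ _ v∈─ ∘ faults⁺
      where
      v∈─ : v Subset.∈ lookup (edges (graph Y)) u ─ lookup (faults q) u
      v∈─ = subst (v Subset.∈_) (Vec.lookup-zipWith _─_ u (edges (graph Y)) (faults q)) v∈

    step : ∀ {u v x y} → label u ≡ x → label v ≡ y → Arc Y x y → ¬ Severed q x y → Reach H u v
    step refl refl arc ¬sev = 1 , cons (edge⁺ arc ¬sev) nil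

    -- While bit q is 0, the root of the out-tree of block q reaches only
    -- vertices with these labels.
    data Trapped : Vertex → Set where
      above : ∀ {p} → p ≼ a → Trapped (at i (out p))
      below : ∀ {p} → h < length p → Trapped (at i (out p))
      aside : ∀ {p} → length p ≤ h → ¬ p ≼ β → Trapped (at i (inn p))

    -- The path to `a` can be left downwards only at its end. As bit `q` is 0 and positions are
    -- distinct, an entry from `a` misses `β`. Every arc by which the rest of the in-tree joins the
    -- path from `β` is cut, so the in-root, the only other way to the exit, stays out of reach.
    trapped-step : lookup Y q ≡ false → ∀ {x y} → Trapped x → Arc Y x y → ¬ Severed q x y → Trapped y
    trapped-step y (above _)        (within (return _)) _ = above (root≼ a)
    trapped-step y (below _)        (within (return _)) _ = above (root≼ a)
    trapped-step y (aside _ _)      (within (return _)) _ = above (root≼ a)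
    trapped-step y (above _)        (within detour) ¬sev = contradiction (severed detour) ¬sev
    trapped-step y (below _)        (within detour) ¬sev = contradiction (severed detour) ¬sev
    trapped-step y (above p≼a)      (within (grow {c = c})) ¬sev with branch p≼a
    -- Below the leaf `a` lie at most surplus nodes, from which no entry starts.
    ... | inj₁ refl = below (s≤s (≤-reflexive (sym (∣row∣ q))))
    ... | inj₂ (b , bp≼a , s∈) with c Bool.≟ b
    ...   | yes refl = above bp≼a
    ...   | no  c≢b with refl ← ¬-not c≢b = contradiction (severed (grow s∈)) ¬sev
    trapped-step y (below h<p)      (within grow) _ = below (m≤n⇒m≤1+n h<p)
    trapped-step y (above p≼a)      (within (entry r y′ i≡ refl refl)) _ =
      aside (≤-reflexive (∣col∣ r)) λ r≼β → r≢q
        (position-injective i≡ (≼-same-length p≼a (trans (∣row∣ r) (sym (∣row∣ q))))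
                               (≼-same-length r≼β (trans (∣col∣ r) (sym (∣col∣ q)))))
      where
      r≢q : r ≢ q
      r≢q refl with () ← trans (sym y) y′
    trapped-step y (below h<p)      (within (entry r _ _ refl _)) _ =
      contradiction (sym (∣row∣ r)) (<⇒≢ h<p)
    trapped-step y (aside p≤h ¬p≼β) (within (shrink {c = c})) ¬sev = aside (<⇒≤ p≤h) off
      where
      off : ¬ _ ≼ β
      off p≼β with branch p≼β
      -- The parent cannot be the leaf `β`, since its child would then be deeper than the bound in
      -- `aside` allows.
      ... | inj₁ refl = <⇒≢ p≤h (∣col∣ q)
      ... | inj₂ (b , bp≼β , s∈) with c Bool.≟ b
      ...   | yes refl = ¬p≼β bp≼β
      ...   | no  c≢b with refl ← ¬-not c≢b = ¬sev (severed (shrink s∈))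
    trapped-step y (aside _ ¬p≼β)   (within finish) _ = contradiction (root≼ β) ¬p≼β

    trapped-walk : lookup Y q ≡ false → ∀ {u v ℓ} → Walk H u v ℓ → Trapped (label u) → Trapped (label v)
    trapped-walk y nil        t = t
    trapped-walk y (cons e p) t = trapped-walk y p (uncurry (trapped-step y t) (edge⁻ e))

    label-root : ∀ {j} → j < M → label (vertex j (out [])) ≡ at j (out [])
    label-root j<M = label-vertex j<M (s≤s z≤n)

    label-exit : ∀ {j} → j < M → label (vertex j exit) ≡ at j exit
    label-exit j<M = label-vertex j<M z≤n

    disconnected : lookup Y q ≡ false → ¬ Reach H (vertex i (out [])) someHub
    disconnected y (_ , p)
      with () ← subst Trapped label-someHub
                  (trapped-walk y p (subst Trapped (sym (label-root (block< q))) (above (root≼ a))))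

    ascend : ∀ {p} → p ≼ a → Reach H (vertex i (out [])) (vertex i (out p))
    ascend {[]}    _    = Reach-refl refl
    ascend {b ∷ p} bp≼a = Reach-trans (ascend (≼-parent bp≼a))
      (step (at-out (≼-parent bp≼a)) (at-out bp≼a) (within grow)
        λ { (severed (grow s∈)) → siblings-off a s∈ bp≼a })
      where
      at-out : ∀ {p} → p ≼ a → label (vertex i (out p)) ≡ at i (out p)
      at-out p≼a = label-vertex (block< q) (s≤s (≤-trans (≼-length p≼a) (≤-reflexive (∣row∣ q))))

    descend : ∀ {p} → p ≼ β → Reach H (vertex i (inn p)) (vertex i (inn []))
    descend {[]}    _    = Reach-refl refl
    descend {b ∷ p} bp≼β = Reach-trans
      (step (at-inn bp≼β) (at-inn (≼-parent bp≼β)) (within shrink)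
        λ { (severed (shrink s∈)) → siblings-off β s∈ bp≼β })
      (descend (≼-parent bp≼β))
      where
      at-inn : ∀ {p} → p ≼ β → label (vertex i (inn p)) ≡ at i (inn p)
      at-inn p≼β = label-vertex (block< q) (s≤s (≤-trans (≼-length p≼β) (≤-reflexive (∣col∣ q))))

    module _ (y : lookup Y q ≡ true) where

      -- Only the block of `q` has lost its direct arc to the exit. There the walk follows the two
      -- intact tree paths, joined by the arc of bit `q`.
      root⇝exit : ∀ {j} → j < M → Reach H (vertex j (out [])) (vertex j exit)
      root⇝exit {j} j<M with j ≟ i
      ... | no  j≢i  = step (label-root j<M) (label-exit j<M) (within detour) λ { (severed _) → j≢i refl }
      ... | yes refl =
        Reach-trans (ascend here)
        (Reach-trans (step (label-vertex j<M (s≤s (≤-reflexive (∣row∣ q))))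
                           (label-vertex j<M (s≤s (≤-reflexive (∣col∣ q))))
                           (within (entry q y refl refl refl)) λ { (severed ()) })
        (Reach-trans (descend here)
        (step (label-vertex j<M (s≤s z≤n)) (label-exit j<M) (within finish) λ { (severed ()) })))

      at⇝root : ∀ {u j k} → label u ≡ at j k → Reach H u (vertex j (out []))
      at⇝root {k = out []} u≡ = Reach-refl (proj₂ (label⁻ u≡))
      at⇝root {k = exit} u≡ =
        step u≡ (label-root (proj₁ (label⁻ u≡))) (within (return λ ())) λ { (severed ()) }
      at⇝root {k = out (_ ∷ _)} u≡ =
        step u≡ (label-root (proj₁ (label⁻ u≡))) (within (return λ ())) λ { (severed ()) }
      at⇝root {k = inn _} u≡ =
        step u≡ (label-root (proj₁ (label⁻ u≡))) (within (return λ ())) λ { (severed ()) }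

      at⇝hub : ∀ {u v j k} → label u ≡ at j k → label v ≡ hub → Reach H u v
      at⇝hub u≡ v≡ = Reach-trans (at⇝root u≡) (Reach-trans (root⇝exit j<M)
        (step (label-exit j<M) v≡ leave λ ()))
        where j<M = proj₁ (label⁻ u≡)

      hub⇝at : ∀ {u v j k} → label u ≡ hub → label v ≡ at j k → Reach H u v
      hub⇝at u≡ v≡ = step u≡ v≡ spread λ ()

      connected : ∀ u v → Reach H u v
      connected u v with label u in u≡ | label v in v≡
      ... | hub    | at _ _ = hub⇝at u≡ v≡
      ... | at _ _ | hub    = at⇝hub u≡ v≡
      ... | at _ _ | at _ _ = Reach-trans (at⇝hub u≡ label-someHub) (hub⇝at label-someHub v≡)
      -- Hubs have no arcs between them; the position `q` supplies a block whose exit links them.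
      ... | hub    | hub    = Reach-trans (hub⇝at u≡ atExit) (at⇝hub atExit v≡)
        where atExit = label-exit (block< q)

  -- Injectivity of the build map

  module _ {f σ} (O : FDO n f) (stretch : HasStretch O σ) (2h<f : suc (h + h) ≤ f) where

    -- A bit that is 1 in `Y` and 0 in `Y′` would let `faults q` leave a finite diameter in one
    -- graph and an infinite one in the other.
    bit-preserved : ∀ {Y Y′} → build O (graph Y) ≡ build O (graph Y′) →
                    ∀ q → lookup Y q ≡ true → lookup Y′ q ≡ true
    bit-preserved {Y} {Y′} eq q y with lookup Y′ q in y′
    ... | true  = refl
    ... | false = contradiction eq
      (stretch-separates {O = O} stretch (faults⊆ Y q) (faults⊆ Y′ q) (≤-trans (∣faults∣ q) 2h<f)
        (proj₂ (finite-diameter (connected Y q y))) (infinite-diameter (disconnected Y′ q y′)))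

    build-injective : ∀ {Y Y′} → build O (graph Y) ≡ build O (graph Y′) → Y ≡ Y′
    build-injective eq = lookup-injective λ q →
      Bool.⇔→≡ (mk⇔ (bit-preserved eq q) (bit-preserved (sym eq) q))

    space : ∀ {b} → UsesSpace≤ O b → m ≤ b
    space short = incompressible (build O ∘ graph) (short ∘ graph) build-injective

-- Takes the least block size that `Construction` admits. A position is a triple of block, row and
-- column in mixed radix, and `bits h` turns row and column numbers into leaves.
space-lower-bound : ∀ h n′ {f σ} (O : FDO (suc n′) f) → HasStretch O σ → suc (h + h) ≤ f →
  ∀ {b} → UsesSpace≤ O b → (n′ / 2 ^ (2 + h)) {{m^n≢0 2 (2 + h)}} * (2 ^ h * 2 ^ h) ≤ b
space-lower-bound h n′ O stretch 2h<f =
  Construction.space h (2 ^ (2 + h)) n′ ≤-refl block row col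
    (λ q → Fin.toℕ<n (quotient {M} (2 ^ h * 2 ^ h) q))
    (λ q → Vec.length-toList (bits h _)) (λ q → Vec.length-toList (bits h _)) injective O stretch 2h<f
  where
  instance
    s≢0 : NonZero (2 ^ (2 + h))
    s≢0 = m^n≢0 2 (2 + h)
  M = n′ / 2 ^ (2 + h)
  cell : Fin (M * (2 ^ h * 2 ^ h)) → Fin (2 ^ h * 2 ^ h)
  cell = remainder {M} (2 ^ h * 2 ^ h)
  block : Fin (M * (2 ^ h * 2 ^ h)) → ℕ
  block q = toℕ (quotient {M} (2 ^ h * 2 ^ h) q)
  row col : Fin (M * (2 ^ h * 2 ^ h)) → List Bool
  row q = Vec.toList (bits h (quotient {2 ^ h} (2 ^ h) (cell q)))
  col q = Vec.toList (bits h (remainder {2 ^ h} (2 ^ h) (cell q)))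
  toList-bits-injective : ∀ {r r′} → Vec.toList (bits h r) ≡ Vec.toList (bits h r′) → r ≡ r′
  toList-bits-injective eq = bits-injective h (trans (sym (Vec.cast-is-id refl _)) (Vec.toList-injective refl _ _ eq))
  injective : ∀ {q r} → block q ≡ block r → row q ≡ row r → col q ≡ col r → q ≡ r
  injective b≡ r≡ c≡ = remQuot-injective {M} (2 ^ h * 2 ^ h) (Fin.toℕ-injective b≡)
    (remQuot-injective {2 ^ h} (2 ^ h) (toList-bits-injective r≡) (toList-bits-injective c≡))

-- The choice of parameters

n<2^n : ∀ n → n < 2 ^ n
n<2^n zero    = z<s
n<2^n (suc n) = begin-strict
  suc n          ≤⟨ n<2^n n ⟩
  2 ^ n          <⟨ m<m+n (2 ^ n) (m^n>0 2 n) ⟩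
  2 ^ n + 2 ^ n  ≡⟨ cong (2 ^ n +_) (+-identityʳ (2 ^ n)) ⟨
  2 ^ suc n      ∎
  where open ≤-Reasoning

square-* : ∀ x y → x ^ 2 * y ^ 2 ≡ (x * y) ^ 2
square-* = solve 2 (λ x y → x :^ 2 :* y :^ 2 := (x :* y) :^ 2) refl
  where open +-*-Solver

-- The depth is reduced by c so that a whole block fits into the n vertices.
depth : ∀ c f → 1 ≤ f → ∃ λ h → suc (h + h) ≤ f × f ≤ (1 + (h + c)) * 2 ×
                                (h ≡ 0 ⊎ suc ((h + c) * 2) ≤ f)
depth c (suc f) _ = h , s≤s h+h≤f , f≤ , room
  where
  open ≤-Reasoning
  -- Here `f` is one less than the fault budget, so `g` is the greatest depth whose `2g + 1` faults
  -- are affordable.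
  g = f / 2
  h = g ∸ c
  h+h≤f : h + h ≤ f
  h+h≤f = begin
    h + h    ≤⟨ +-mono-≤ (m∸n≤m g c) (m∸n≤m g c) ⟩
    g + g    ≡⟨ cong (g +_) (+-identityʳ g) ⟨
    2 * g    ≡⟨ *-comm 2 g ⟩
    g * 2    ≤⟨ m/n*n≤m f 2 ⟩
    f        ∎
  f≤ : suc f ≤ (1 + (h + c)) * 2
  f≤ = begin
    suc f                ≡⟨ cong suc (m≡m%n+[m/n]*n f 2) ⟩
    suc (f % 2 + g * 2)  ≤⟨ +-monoˡ-≤ (g * 2) (m%n<n f 2) ⟩
    (1 + g) * 2          ≤⟨ *-monoˡ-≤ 2 (s≤s (≤-trans (m≤n+m∸n g c) (≤-reflexive (+-comm c h)))) ⟩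
    (1 + (h + c)) * 2    ∎
  room : h ≡ 0 ⊎ suc ((h + c) * 2) ≤ suc f
  room with ≤-total g c
  ... | inj₁ g≤c = inj₁ (m≤n⇒m∸n≡0 g≤c)
  ... | inj₂ c≤g = inj₂ (s≤s (begin
    (h + c) * 2  ≡⟨ cong (_* 2) (m∸n+n≡m c≤g) ⟩
    g * 2        ≤⟨ m/n*n≤m f 2 ⟩
    f            ∎))

-- For `h = 0` a block has four vertices, whence the threshold 5. Otherwise `h + 2 + C` is below
-- `f / 2`; if `n ≤ 2 ^ (2 + h)`, then `C ≤ 2 ^ C` puts `C * n` below the square root of `2 ^ f`,
-- against the hypothesis. The inequality is strict to leave room for a hub.
block-fits : ∀ C n f h → 5 ≤ n → 2^[ f /2]· 1 ≤ C * n →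
             h ≡ 0 ⊎ suc ((h + (2 + C)) * 2) ≤ f → 2 ^ (2 + h) < n
block-fits C n f .0 5≤n _ (inj₁ refl) = 5≤n
block-fits C n f h  _ hyp (inj₂ room) = ≰⇒> λ n≤s → <-irrefl refl (begin-strict
  (C * n) ^ 2                    ≤⟨ ^-monoˡ-≤ 2 (*-mono-≤ (<⇒≤ (n<2^n C)) n≤s) ⟩
  (2 ^ C * 2 ^ (2 + h)) ^ 2      ≡⟨ cong (_^ 2) (^-distribˡ-+-* 2 C (2 + h)) ⟨
  (2 ^ (C + (2 + h))) ^ 2        ≡⟨ ^-*-assoc 2 (C + (2 + h)) 2 ⟩
  2 ^ ((C + (2 + h)) * 2)        ≡⟨ cong (λ e → 2 ^ (e * 2)) (solve 2 (λ C h → C :+ (con 2 :+ h) := h :+ (con 2 :+ C)) refl C h) ⟩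
  2 ^ ((h + (2 + C)) * 2)        <⟨ ^-monoʳ-< 2 (s≤s z<s) room ⟩
  2 ^ f                          ≡⟨ *-identityʳ (2 ^ f) ⟨
  2 ^ f * 1 ^ 2                  ≤⟨ hyp ⟩
  (C * n) ^ 2                    ∎)
  where
  open ≤-Reasoning
  open +-*-Solver using (solve; con; _:+_; _:=_)

-- At least one full block is present and the remainder is smaller than a block, so rounding costs a
-- factor of at most two, even with the extra hub counted by `suc`.
suc≤2*[m/n]*n : ∀ m n .{{_ : NonZero n}} → n ≤ m → suc m ≤ 2 * (m / n * n)
suc≤2*[m/n]*n m n n≤m = begin
  suc m                        ≡⟨ cong suc (m≡m%n+[m/n]*n m n) ⟩
  suc (m % n + m / n * n)      ≤⟨ +-monoˡ-≤ (m / n * n) (m%n<n m n) ⟩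
  n + m / n * n                ≡⟨ cong (_+ m / n * n) (*-identityˡ n) ⟨
  1 * n + m / n * n            ≤⟨ +-monoˡ-≤ (m / n * n) (*-monoˡ-≤ n (m≥n⇒m/n>0 n≤m)) ⟩
  m / n * n + m / n * n        ≡⟨ cong (m / n * n +_) (+-identityʳ (m / n * n)) ⟨
  2 * (m / n * n)              ∎
  where open ≤-Reasoning

theorem4 : ∀ (C : ℕ) → ∃₂ λ (k N : ℕ) → 1 ≤ k ×
    (∀ (n f : ℕ) → 1 ≤ n → 1 ≤ f → N ≤ n → 2^[ f /2]· 1 ≤ C * n →
    ∀ (σ : ℚ) (O : FDO n f) → HasStretch O σ →
    ∀ (b : ℕ) → UsesSpace≤ O b → 2^[ f /2]· n ≤ k * b)
theorem4 C = 2 ^ (6 + C) , 5 , m^n>0 2 (6 + C) , bound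
  where
  open ≤-Reasoning
  bound : ∀ (n f : ℕ) → 1 ≤ n → 1 ≤ f → 5 ≤ n → 2^[ f /2]· 1 ≤ C * n →
          ∀ (σ : ℚ) (O : FDO n f) → HasStretch O σ →
          ∀ (b : ℕ) → UsesSpace≤ O b → 2^[ f /2]· n ≤ 2 ^ (6 + C) * b
  bound n@(suc n′) f _ 1≤f 5≤n hyp σ O stretch b short
    with h , 2h<f , f≤ , room ← depth (2 + C) f 1≤f = begin
    2 ^ f * n ^ 2                        ≤⟨ *-mono-≤ (^-monoʳ-≤ 2 f≤) (^-monoˡ-≤ 2 (suc≤2*[m/n]*n n′ s s≤n′)) ⟩
    2 ^ (e * 2) * (2 * (M * s)) ^ 2      ≡⟨ cong (_* (2 * (M * s)) ^ 2) (^-*-assoc 2 e 2) ⟨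
    (2 ^ e) ^ 2 * (2 * (M * s)) ^ 2      ≡⟨ square-* (2 ^ e) (2 * (M * s)) ⟩
    (2 ^ e * (2 * (M * s))) ^ 2          ≡⟨ cong (_^ 2) regroup ⟩
    (2 ^ (6 + C) * (M * (x * x))) ^ 2    ≤⟨ ^-monoˡ-≤ 2 (*-monoʳ-≤ (2 ^ (6 + C)) (space-lower-bound h n′ O stretch 2h<f short)) ⟩
    (2 ^ (6 + C) * b) ^ 2                ∎
    where
    instance
      s≢0 : NonZero (2 ^ (2 + h))
      s≢0 = m^n≢0 2 (2 + h)
    e = 1 + (h + (2 + C))
    x = 2 ^ h
    s = 2 ^ (2 + h)
    M = n′ / s
    s≤n′ : s ≤ n′
    s≤n′ = ≤-pred (block-fits C n f h 5≤n hyp room)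
    -- The exponent `6 + C` collects `3 + C` from `e` beyond `h`, 1 from the rounding and 2 from
    -- `s = 4 * x`.
    regroup : 2 ^ e * (2 * (M * s)) ≡ 2 ^ (6 + C) * (M * (x * x))
    regroup = trans (cong (_* (2 * (M * s))) (cong (2 *_) (^-distribˡ-+-* 2 h (2 + C))))
      (solve 3 (λ x z M → con 2 :* (x :* (con 2 :* (con 2 :* z))) :* (con 2 :* (M :* (con 2 :* (con 2 :* x))))
                       := con 2 :* (con 2 :* (con 2 :* (con 2 :* (con 2 :* (con 2 :* z))))) :* (M :* (x :* x)))
        refl x (2 ^ C) M)
      where open +-*-Solver using (solve; con; _:*_; _:=_)
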